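{- For any integer $\gamma \geq 0$, the vector space of nonempty words on $\{0\} \cup [\gamma]$ containing exactly one occurrence of $0$, endowed with the linear operations $\dashv_a, \vdash_a$, $a \in [\gamma]$, defined on such words $u$ and $v$ by $$u \dashv_a v := u\, \mathrm{h}_a(v), \qquad u \vdash_a v := \mathrm{h}_a(u)\, v$$ (concatenation of words), where $\mathrm{h}_a(w)$ is the word obtained by replacing in $w$ every occurrence of a letter smaller than $a$ by $a$, is the free $\gamma$-pluriassociative algebra over one generator.
   Context: The ground field has characteristic zero; $[\gamma]=\{1,\dots,\gamma\}$. A $\gamma$-pluriassociative algebra is an algebra over the nonsymmetric operad $\mathsf{Dias}_\gamma$, which is the operad generated by the words $0a$, $a0$, $a\in[\gamma]$, inside the operad of words on $\{0\}\cup[\gamma]$ (arity = length) with partial compositions $u \circ_i v := u_1 \dots u_{i-1}\max(u_i, v_1) \dots \max(u_i, v_m) u_{i+1} \dots u_n$ and unit the word $0$; the operation $\dashv_a$ is the action of $0a$ and $\vdash_a$ the action of $a0$. Equivalently, it is a vector space with bilinear operations $\dashv_a, \vdash_a$, $a \in [\gamma]$, such that for all elements $x,y,z$ and all $a, a' \in [\gamma]$, with $a \uparrow a' := \max(a,a')$: $(x \vdash_{a'} y) \dashv_a z = x \vdash_{a'} (y \dashv_a z)$; $(x \dashv_{a\uparrow a'} y) \dashv_a z = x \dashv_a (y \vdash_{a'} z)$; $(x \dashv_{a'} y) \vdash_a z = x \vdash_a (y \vdash_{a \uparrow a'} z)$; $(x \dashv_a y) \dashv_{a\uparrow a'} z =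 x \dashv_a (y \dashv_{a'} z)$; $(x \vdash_{a'} y) \vdash_a z = x \vdash_{a \uparrow a'} (y \vdash_a z)$. The free algebra over one generator on a nonsymmetric operad $\mathcal{O}$ is $\bigoplus_{n\ge1}\mathcal{O}(n)$ with action $x(e_1,\dots,e_n) := x\circ(e_1,\dots,e_n)$ (full operadic composition), the generator being the operad unit (here the word $0$). -}

module Defs where

open import Algebra.Apartness.Bundles using (HeytingField)
open import Algebra.Bundles using (CommutativeRing)
open import Algebra.Core using (Op₁; Op₂)
open import Algebra.Module.Bundles using (Module)
open import Algebra.Module.Morphism.Structures using (IsModuleIsomorphism)
open import Algebra.Module.Structures.Biased using (IsModuleFromLeft)
import Algebra.Construct.NaturalChoice.Max as Max
import Algebra.Definitions.RawMonoid as Mult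
import Algebra.Properties.Ring as RingProperties
open import Data.Bool.Base using (true; false; if_then_else_)
open import Data.Fin.Base using (Fin; zero; suc)
import Data.Fin.Properties as Fin
open import Data.Irrelevant using (Irrelevant; [_])
open import Data.List.Base as List
  using (List; []; _∷_; _++_; length; filter; cartesianProductWith)
import Data.List.Properties as List
open import Data.List.Membership.Propositional using (_∈_)
open import Data.List.Relation.Unary.All as All using (All; []; _∷_; _[_]≔_)
import Data.List.Relation.Unary.All.Properties as All
open import Data.Nat.Base as ℕ using (ℕ)
open import Data.Product.Base using (_×_; _,_; map₁; map₂)
open import Data.Refinement as Refinement
  using (Refinement-syntax; value) renaming (_,_ to _,ʳ_)
open import Function.Base using (const)
open import Level using (_⊔_)
open import Relation.Binary.Core using (Rel)
open import Relation.Binary.Definitions using (DecidableEquality)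
open import Relation.Binary.PropositionalEquality
  using (_≡_; refl; cong; cong₂; sym; subst; module ≡-Reasoning)
open import Relation.Nullary.Decidable.Core using (does)

module _ {c ℓ₁ ℓ₂} (K : HeytingField c ℓ₁ ℓ₂) where

  private module K = HeytingField K

  scalars : CommutativeRing c ℓ₁
  scalars = record { isCommutativeRing = K.isCommutativeRing }

  CharacteristicZero : Set ℓ₁
  CharacteristicZero = ∀ n → (n ×ₙ K.1#) K.≈ K.0# → n ≡ 0
    where
    open Mult (CommutativeRing.+-rawMonoid scalars) renaming (_×_ to _×ₙ_)

module Free {c ℓ x} (R : CommutativeRing c ℓ)
            {X : Set x} (_≟_ : DecidableEquality X) where

  open CommutativeRing R renaming (refl to ≈-refl; sym to ≈-sym; trans to ≈-trans)

  Combination : Set (c ⊔ x)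
  Combination = List (Carrier × X)

  coeff : Combination → X → Carrier
  coeff []            y = 0#
  coeff ((k , x) ∷ p) y = (if does (x ≟ y) then k else 0#) + coeff p y

  -- Formal sums are not normalised: they are identified when they have
  -- the same coefficients.
  infix 4 _≋_
  _≋_ : Rel Combination (x ⊔ ℓ)
  p ≋ q = ∀ y → coeff p y ≈ coeff q y

  infixr 7 _·_
  _·_ : Carrier → Combination → Combination
  k · p = List.map (map₁ (k *_)) p

  neg : Op₁ Combination
  neg p = (- 1#) · p

  basis : X → Combination
  basis x = (1# , x) ∷ []

  coeff-++ : ∀ p q y → coeff (p ++ q) y ≈ coeff p y + coeff q y
  coeff-++ []            q y = ≈-sym (+-identityˡ _)
  coeff-++ ((k , x) ∷ p) q y =
    ≈-trans (+-congˡ (coeff-++ p q y)) (≈-sym (+-assoc _ _ _))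

  coeff-· : ∀ k p y → coeff (k · p) y ≈ k * coeff p y
  coeff-· k []            y = ≈-sym (zeroʳ k)
  coeff-· k ((l , x) ∷ p) y with does (x ≟ y)
  ... | true  = ≈-trans (+-congˡ (coeff-· k p y)) (≈-sym (distribˡ k l _))
  ... | false = ≈-trans (+-cong (≈-sym (zeroʳ k)) (coeff-· k p y))
                        (≈-sym (distribˡ k 0# _))

  coeff-neg : ∀ p y → coeff (neg p) y ≈ - coeff p y
  coeff-neg p y =
    ≈-trans (coeff-· (- 1#) p y) (RingProperties.-1*x≈-x ring _)

  private
    from : ∀ {a b a' b'} → a ≈ a' → b ≈ b' → a' ≈ b' → a ≈ b
    from r s t = ≈-trans r (≈-trans t (≈-sym s))

  freeModule : Module R (c ⊔ x) (x ⊔ ℓ)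
  freeModule = record
    { Carrierᴹ = Combination
    ; _≈ᴹ_     = _≋_
    ; _+ᴹ_     = _++_
    ; _*ₗ_     = _·_
    ; _*ᵣ_     = λ p k → k · p
    ; 0ᴹ       = []
    ; -ᴹ_      = neg
    ; isModule = IsModuleFromLeft.isModule {commutativeRing = R} (record
      { isLeftModule = record
        { isLeftSemimodule = record
          { +ᴹ-isCommutativeMonoid = record
            { isMonoid = record
              { isSemigroup = record
                { isMagma = record
                  { isEquivalence = record
                    { refl  = λ y → ≈-refl
                    ; sym   = λ e y → ≈-sym (e y)
                    ; trans = λ e f y → ≈-trans (e y) (f y)
                    }
                  ; ∙-cong = λ {p} {p'} {q} {q'} e f y →
                      from (coeff-++ p q y) (coeff-++ p' q' y) (+-cong (e y) (f y))
                  }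
                ; assoc = λ p q r y → reflexive (cong (λ s → coeff s y) (List.++-assoc p q r))
                }
              ; identity = (λ p y → ≈-refl)
                         , (λ p y → reflexive (cong (λ s → coeff s y) (List.++-identityʳ p)))
              }
            ; comm = λ p q y →
                from (coeff-++ p q y) (coeff-++ q p y) (+-comm _ _)
            }
          ; isPreleftSemimodule = record
            { *ₗ-cong = λ {k} {l} {p} {q} e f y →
                from (coeff-· k p y) (coeff-· l q y) (*-cong e (f y))
            ; *ₗ-zeroˡ = λ p y → ≈-trans (coeff-· 0# p y) (zeroˡ _)
            ; *ₗ-distribʳ = λ p k l y →
                from (coeff-· (k + l) p y)
                     (≈-trans (coeff-++ (k · p) (l · p) y)
                              (+-cong (coeff-· k p y) (coeff-· l p y)))
                     (distribʳ _ k l)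
            ; *ₗ-identityˡ = λ p y → ≈-trans (coeff-· 1# p y) (*-identityˡ _)
            ; *ₗ-assoc = λ k l p y →
                from (coeff-· (k * l) p y)
                     (≈-trans (coeff-· k (l · p) y) (*-congˡ (coeff-· l p y)))
                     (*-assoc k l _)
            ; *ₗ-zeroʳ = λ k y → ≈-refl
            ; *ₗ-distribˡ = λ k p q y →
                from (≈-trans (coeff-· k (p ++ q) y) (*-congˡ (coeff-++ p q y)))
                     (≈-trans (coeff-++ (k · p) (k · q) y)
                              (+-cong (coeff-· k p y) (coeff-· k q y)))
                     (distribˡ k _ _)
            }
          }
        ; -ᴹ‿cong = λ {p} {q} e y →
            from (coeff-neg p y) (coeff-neg q y) (-‿cong (e y))
        ; -ᴹ‿inverse =
            (λ p y → ≈-trans (coeff-++ (neg p) p y)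
                       (≈-trans (+-congʳ (coeff-neg p y)) (-‿inverseˡ _)))
          , (λ p y → ≈-trans (coeff-++ p (neg p) y)
                       (≈-trans (+-congˡ (coeff-neg p y)) (-‿inverseʳ _)))
        }
      })
    }

  bilinear : Op₂ X → Op₂ Combination
  bilinear f = cartesianProductWith (λ (k , x) (l , y) → k * l , f x y)

  -- A family of elements of Y, one per letter of u, is an inhabitant of
  -- All (const Y) u.
  expand : ∀ {a} {A : Set a} {u : List A} →
           All (const Combination) u → List (Carrier × All (const X) u)
  expand []       = (1# , []) ∷ []
  expand (p ∷ ps) =
    cartesianProductWith (λ (k , x) (l , xs) → k * l , x ∷ xs) p (expand ps)

  multilinear : ∀ {a} {A : Set a} {u : List A} →
                (All (const X) u → X) → All (const Combination) u → Combination
  multilinear f ps = List.map (map₂ f) (expand ps)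

module _ (γ : ℕ) where

  Word : Set
  Word = List (Fin (ℕ.suc γ))

module _ {γ : ℕ} where

  infixl 6 _↑_
  _↑_ : Op₂ (Fin (ℕ.suc γ))
  _↑_ = Max._⊔_ (Fin.≤-totalOrder (ℕ.suc γ))

  _≟ʷ_ : DecidableEquality (Word γ)
  _≟ʷ_ = List.≡-dec Fin._≟_

  -- An index a ∈ [γ] is encoded as an element of Fin γ; the corresponding
  -- letter is its successor.
  letter : Fin γ → Fin (ℕ.suc γ)
  letter = suc

  -- Partial composition in the operad of words. Positions are 0-based.
  infixl 7 _∘⟨_⟩_
  _∘⟨_⟩_ : (u : Word γ) → Fin (length u) → Word γ → Word γ
  (a ∷ u) ∘⟨ zero  ⟩ v = List.map (a ↑_) v ++ u
  (a ∷ u) ∘⟨ suc i ⟩ v = a ∷ (u ∘⟨ i ⟩ v)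

  -- Full composition u ∘ (v₁ , … , vₙ), that is
  -- (… ((u ∘ₙ vₙ) ∘ₙ₋₁ vₙ₋₁) …) ∘₁ v₁: the compositions at positions n, …, 2
  -- leave the first letter of u in place.
  compose : (u : Word γ) → All (const (Word γ)) u → Word γ
  compose []      []       = []
  compose (a ∷ u) (v ∷ vs) = (a ∷ compose u vs) ∘⟨ zero ⟩ v

  0ʷ : Word γ
  0ʷ = zero ∷ []

  0·_ : Fin γ → Word γ
  0· a = zero ∷ letter a ∷ []

  _·0 : Fin γ → Word γ
  a ·0 = letter a ∷ zero ∷ []

  data Generated : Word γ → Set where
    unit  : Generated 0ʷ
    left  : ∀ a → Generated (0· a)
    right : ∀ a → Generated (a ·0)
    comp  : ∀ {u v} → Generated u → (i : Fin (length u)) → Generated v →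
            Generated (u ∘⟨ i ⟩ v)

-- All arities together: an operation of arity n is a word of length n.
-- As a linear operad, Dias γ in arity n is the span of its words of length n.
Dias : ℕ → Set
Dias γ = [ w ∈ Word γ ∣ Generated w ]

module _ {γ : ℕ} where

  unitᴰ : Dias γ
  unitᴰ = 0ʷ ,ʳ [ unit ]

  leftᴰ rightᴰ : Fin γ → Dias γ
  leftᴰ  a = (0· a) ,ʳ [ left a ]
  rightᴰ a = (a ·0) ,ʳ [ right a ]

  compᴰ : (x : Dias γ) → Fin (length (value x)) → Dias γ → Dias γ
  compᴰ (u ,ʳ [ p ]) i (v ,ʳ [ q ]) = (u ∘⟨ i ⟩ v) ,ʳ [ comp p i q ]

  private
    comp-at : ∀ (r : Word γ) {a} {u v : Word γ} → Generated (r ++ a ∷ u) → Generated v →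
              Generated (r ++ List.map (a ↑_) v ++ u)
    comp-at r {a} {u} {v} p q =
      subst Generated (position-∘ r) (comp p (position r) q)
      where
      position : (r : Word γ) → Fin (length (r ++ a ∷ u))
      position []      = zero
      position (_ ∷ r) = suc (position r)

      position-∘ : (r : Word γ) → (r ++ a ∷ u) ∘⟨ position r ⟩ v
                       ≡ r ++ List.map (a ↑_) v ++ u
      position-∘ []      = refl
      position-∘ (b ∷ r) = cong (b ∷_) (position-∘ r)

    compose-generated : (r u : Word γ) (ys : All (const (Dias γ)) u) → .(Generated (r ++ u)) →
                        Irrelevant (Generated (r ++ compose u (All.map value ys)))
    compose-generated r []      []                  p = [ p ]
    compose-generated r (a ∷ u) ((v ,ʳ [ q ]) ∷ ys) p
      with compose-generated (r ++ a ∷ []) u ys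
             (subst Generated (sym (List.++-assoc r (a ∷ []) u)) p)
    ... | [ s ] =
      [ comp-at r {v = v} (subst Generated (List.++-assoc r (a ∷ []) _) s) q ]

  composeᴰ : (x : Dias γ) → All (const (Dias γ)) (value x) → Dias γ
  composeᴰ (u ,ʳ [ p ]) ys =
    compose u (All.map value ys) ,ʳ compose-generated [] u ys p

  -- Given operands for u ∘⟨ i ⟩ v, feed those lying over v to f and keep the
  -- others, so as to obtain operands for u.
  graft : ∀ {m} {M : Set m} (u : Word γ) (i : Fin (length u)) (v : Word γ) →
          (All (const M) v → M) → All (const M) (u ∘⟨ i ⟩ v) → All (const M) u
  graft (a ∷ u) zero    v f es       =
    f (All.map⁻ (All.++⁻ˡ (List.map (a ↑_) v) es)) ∷ All.++⁻ʳ (List.map (a ↑_) v) es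
  graft (a ∷ u) (suc i) v f (e ∷ es) = e ∷ graft u i v f es

module _ {c ℓ m ℓm} {R : CommutativeRing c ℓ} (γ : ℕ) (M : Module R m ℓm) where

  open Module M

  -- Actions of the linear operad, given on its basis of words.
  Action : Set m
  Action = (x : Dias γ) → All (const Carrierᴹ) (value x) → Carrierᴹ

  record IsDiasAlgebra (act : Action) : Set (c ⊔ m ⊔ ℓm) where
    field
      act-cong : ∀ x {es es'} →
                 (∀ {a} (i : a ∈ value x) → All.lookup es i ≈ᴹ All.lookup es' i) →
                 act x es ≈ᴹ act x es'
      act-+    : ∀ x es {a} (i : a ∈ value x) e f →
                 act x (es [ i ]≔ (e +ᴹ f)) ≈ᴹ act x (es [ i ]≔ e) +ᴹ act x (es [ i ]≔ f)
      act-*    : ∀ x es {a} (i : a ∈ value x) k e →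
                 act x (es [ i ]≔ (k *ₗ e)) ≈ᴹ k *ₗ act x (es [ i ]≔ e)
      act-unit : ∀ e → act unitᴰ (e ∷ []) ≈ᴹ e
      act-∘    : ∀ x i y es →
                 act (compᴰ x i y) es ≈ᴹ act x (graft (value x) i (value y) (act y) es)

  -- A γ-pluriassociative algebra is a Dias γ-algebra; it is presented by the
  -- operations through which the generators 0a and a0 act.
  record IsPluriassociative (_⊣⟨_⟩_ _⊢⟨_⟩_ : Carrierᴹ → Fin γ → Carrierᴹ → Carrierᴹ)
                            : Set (c ⊔ m ⊔ ℓm) where
    field
      act           : Action
      isDiasAlgebra : IsDiasAlgebra act
      act-left      : ∀ a e f → act (leftᴰ a)  (e ∷ f ∷ []) ≈ᴹ e ⊣⟨ a ⟩ f
      act-right     : ∀ a e f → act (rightᴰ a) (e ∷ f ∷ []) ≈ᴹ e ⊢⟨ a ⟩ f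

-- The free Dias γ-algebra over one generator, ⊕ₙ Dias γ (n): a direct sum of
-- spans of words of length n is the span of all the words.
module FreeDias {c ℓ} (R : CommutativeRing c ℓ) (γ : ℕ) where

  open Free R (Refinement._≟_ _≟ʷ_ {P = Generated {γ}}) public

  freeAction : Action γ freeModule
  freeAction x = multilinear (composeᴰ x)

  generator : Combination
  generator = basis unitᴰ

module _ {c ℓ m ℓm} {R : CommutativeRing c ℓ} (γ : ℕ) (M : Module R m ℓm) where

  open Module M
  private module F = FreeDias R γ

  record IsFreePluriassociativeOver
           (_⊣⟨_⟩_ _⊢⟨_⟩_ : Carrierᴹ → Fin γ → Carrierᴹ → Carrierᴹ)
           (g : Carrierᴹ) : Set (c ⊔ ℓ ⊔ m ⊔ ℓm) where
    field
      isPluriassociative : IsPluriassociative γ M _⊣⟨_⟩_ _⊢⟨_⟩_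

    open IsPluriassociative isPluriassociative public

    field
      φ           : F.Combination → Carrierᴹ
      φ-iso       : IsModuleIsomorphism (Module.rawModule F.freeModule) rawModule φ
      φ-act       : ∀ x es → φ (F.freeAction x es) ≈ᴹ act x (All.map φ es)
      φ-generator : φ F.generator ≈ᴹ g

module _ {γ : ℕ} where

  zeros : Word γ → ℕ
  zeros w = length (filter (Fin._≟ zero) w)

  h : Fin γ → Word γ → Word γ
  h a = List.map (λ b → if does (b Fin.<? letter a) then letter a else b)

-- Such words are automatically nonempty.
OneZero : ℕ → Set
OneZero γ = [ w ∈ Word γ ∣ zeros w ≡ 1 ]

module _ {γ : ℕ} where

  private
    zeros-++ : (u v : Word γ) → zeros (u ++ v) ≡ zeros u ℕ.+ zeros v
    zeros-++ u v = begin
      length (filter (Fin._≟ zero) (u ++ v))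
        ≡⟨ cong length (List.filter-++ (Fin._≟ zero) u v) ⟩
      length (filter (Fin._≟ zero) u ++ filter (Fin._≟ zero) v)
        ≡⟨ List.length-++ (filter (Fin._≟ zero) u) ⟩
      zeros u ℕ.+ zeros v ∎
      where open ≡-Reasoning

    zeros-h : ∀ a (v : Word γ) → zeros (h a v) ≡ 0
    zeros-h a []          = refl
    zeros-h a (zero ∷ v)  = zeros-h a v
    zeros-h a (suc b ∷ v) with does (suc b Fin.<? letter a)
    ... | true  = zeros-h a v
    ... | false = zeros-h a v

  ⊣-word : Fin γ → Op₂ (OneZero γ)
  ⊣-word a (u ,ʳ [ p ]) (v ,ʳ _) = (u ++ h a v) ,ʳ [ one p ]
    where
    one : zeros u ≡ 1 → zeros (u ++ h a v) ≡ 1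
    one p = begin
      zeros (u ++ h a v)         ≡⟨ zeros-++ u (h a v) ⟩
      zeros u ℕ.+ zeros (h a v)  ≡⟨ cong₂ ℕ._+_ p (zeros-h a v) ⟩
      1                          ∎
      where open ≡-Reasoning

  ⊢-word : Fin γ → Op₂ (OneZero γ)
  ⊢-word a (u ,ʳ _) (v ,ʳ [ q ]) = (h a u ++ v) ,ʳ [ one q ]
    where
    one : zeros v ≡ 1 → zeros (h a u ++ v) ≡ 1
    one q = begin
      zeros (h a u ++ v)         ≡⟨ zeros-++ (h a u) v ⟩
      zeros (h a u) ℕ.+ zeros v  ≡⟨ cong₂ ℕ._+_ (zeros-h a u) q ⟩
      1                          ∎
      where open ≡-Reasoning

module OneZeroWords {c ℓ} (R : CommutativeRing c ℓ) (γ : ℕ) where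

  open Free R (Refinement._≟_ _≟ʷ_ {P = λ w → zeros {γ} w ≡ 1}) public

  infixl 6 _⊣⟨_⟩_ _⊢⟨_⟩_
  _⊣⟨_⟩_ _⊢⟨_⟩_ : Combination → Fin γ → Combination → Combination
  p ⊣⟨ a ⟩ q = bilinear (⊣-word a) p q
  p ⊢⟨ a ⟩ q = bilinear (⊢-word a) p q

  zeroWord : Combination
  zeroWord = basis (0ʷ ,ʳ [ refl ])

-- A word lies in Dias γ exactly when it contains a single 0: composing into a
-- letter a replaces v by max(a , v), which keeps the 0 of v if a = 0 and has no
-- 0 otherwise; conversely b w = (b 0) ∘₂ w and w b = (0 b) ∘₁ w, so every such
-- word is built from 0 letter by letter. Hence Dias γ and the words with one 0
-- are two bases in bijection. Since h a maps max(a , _) over a word, composing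
-- 0a and a0 with two words gives the operations of the statement, and the
-- operadic axioms hold on words, thus on formal sums by multilinearity.

module Submission where

open import Algebra.Apartness.Bundles using (HeytingField)
open import Algebra.Bundles using (CommutativeRing)
import Algebra.Construct.NaturalChoice.Max as Max
open import Algebra.Module.Bundles using (Module)
open import Algebra.Module.Morphism.Structures using (IsModuleIsomorphism)
import Algebra.Properties.Group as GroupProperties
open import Data.Bool.Base using (true; false; if_then_else_)
open import Data.Fin.Base as Fin using (Fin; zero; suc)
import Data.Fin.Properties as Fin
open import Data.Irrelevant as Irrelevant using ([_])
open import Data.List.Base as List
  using (List; []; _∷_; _++_; length; filter; cartesianProductWith)
import Data.List.Properties as List
open import Data.List.Membership.Propositional using (_∈_)
open import Data.List.Relation.Unary.All as All using (All; []; _∷_; _[_]≔_)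
import Data.List.Relation.Unary.All.Properties as All
open import Data.List.Relation.Unary.Any using (here; there)
open import Data.Nat.Base as ℕ using (ℕ; z≤n; s≤s)
import Data.Nat.Properties as ℕ
open import Data.Product.Base using (_×_; _,_; map₂)
open import Data.Refinement as Refinement
  using (value) renaming (_,_ to _,ʳ_)
open import Data.Refinement.Properties using (value-injective)
open import Function.Base using (const; _∘_)
open import Relation.Binary.Definitions using (DecidableEquality)
open import Relation.Binary.PropositionalEquality as ≡
  using (_≡_; refl; cong; cong₂; sym; trans; subst; module ≡-Reasoning)
import Relation.Binary.Reasoning.Setoid as ≈-Reasoning
open import Relation.Nullary.Decidable.Core using (Dec; does; yes; no)
open import Relation.Nullary.Negation.Core using (¬_; contradiction)
open import Defs

-- Linear extension of scalar functions to formal sums.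

module LinearExtension {c ℓ} (R : CommutativeRing c ℓ) where

  open CommutativeRing R
    renaming (refl to ≈-refl; sym to ≈-sym; trans to ≈-trans)
  open ≈-Reasoning setoid
  open import Algebra.Properties.CommutativeSemigroup +-commutativeSemigroup
    using (interchange; x∙yz≈y∙xz)
  open import Algebra.Properties.CommutativeSemigroup *-commutativeSemigroup
    using () renaming (x∙yz≈y∙xz to x*yz≈y*xz)

  FormalSum : ∀ {x} → Set x → Set _
  FormalSum X = List (Carrier × X)

  -- The linear functional with prescribed values on the basis, computed on an unnormalised
  -- representative. That it respects `≋` is proved only in `extend-≋`.
  extend : ∀ {x} {X : Set x} → (X → Carrier) → FormalSum X → Carrier
  extend F []            = 0#
  extend F ((k , x) ∷ p) = k * F x + extend F p

  module _ {x} {X : Set x} where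

    extend-cong : ∀ {F G : X → Carrier} → (∀ x → F x ≈ G x) →
                  ∀ p → extend F p ≈ extend G p
    extend-cong e []            = ≈-refl
    extend-cong e ((k , x) ∷ p) = +-cong (*-congˡ (e x)) (extend-cong e p)

    extend-++ : ∀ (F : X → Carrier) p q →
                extend F (p ++ q) ≈ extend F p + extend F q
    extend-++ F []            q = ≈-sym (+-identityˡ _)
    extend-++ F ((k , x) ∷ p) q =
      ≈-trans (+-congˡ (extend-++ F p q)) (≈-sym (+-assoc _ _ _))

    extend-+ : ∀ (F G : X → Carrier) p →
               extend (λ x → F x + G x) p ≈ extend F p + extend G p
    extend-+ F G []            = ≈-sym (+-identityˡ _)
    extend-+ F G ((k , x) ∷ p) =
      ≈-trans (+-cong (distribˡ k _ _) (extend-+ F G p)) (interchange _ _ _ _)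

    extend-* : ∀ k (F : X → Carrier) p →
               extend (λ x → k * F x) p ≈ k * extend F p
    extend-* k F []            = ≈-sym (zeroʳ k)
    extend-* k F ((l , x) ∷ p) =
      ≈-trans (+-cong (x*yz≈y*xz l k _) (extend-* k F p)) (≈-sym (distribˡ k _ _))

  extend-map₂ : ∀ {x y} {X : Set x} {Y : Set y} (F : Y → Carrier) (f : X → Y) p →
                extend F (List.map (map₂ f) p) ≈ extend (F ∘ f) p
  extend-map₂ F f []      = ≈-refl
  extend-map₂ F f (_ ∷ p) = +-congˡ (extend-map₂ F f p)

  -- A sum over a product list is an iterated sum. Both `bilinear` and `expand` are built from such
  -- products, so this evaluates them both.
  extend-cartesianProductWith :
    ∀ {x y z} {X : Set x} {Y : Set y} {Z : Set z}
    (F : Z → Carrier) (f : X → Y → Z) p q →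
    extend F (cartesianProductWith (λ (k , x) (l , y) → k * l , f x y) p q) ≈
    extend (λ x → extend (F ∘ f x) q) p
  extend-cartesianProductWith F f []            q = ≈-refl
  extend-cartesianProductWith F f ((k , x) ∷ p) q = ≈-trans
    (extend-++ F (List.map (λ (l , y) → k * l , f x y) q) _)
    (+-cong (row q) (extend-cartesianProductWith F f p q))
    where
    row : ∀ q → extend F (List.map (λ (l , y) → k * l , f x y) q) ≈
                k * extend (F ∘ f x) q
    row []            = ≈-sym (zeroʳ k)
    row ((l , y) ∷ q) =
      ≈-trans (+-cong (*-assoc k l _) (row q)) (≈-sym (distribˡ k _ _))

  module _ {x} {X : Set x} (_≟_ : DecidableEquality X) where

    open Free R _≟_

    δ : X → X → Carrier
    δ y x = if does (x ≟ y) then 1# else 0#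

    coeff≈extend : ∀ p y → coeff p y ≈ extend (δ y) p
    coeff≈extend []            y = ≈-refl
    coeff≈extend ((k , x) ∷ p) y with does (x ≟ y)
    ... | true  = +-cong (≈-sym (*-identityʳ k)) (coeff≈extend p y)
    ... | false = +-cong (≈-sym (zeroʳ k)) (coeff≈extend p y)

    -- Each coefficient is itself a linear extension, that of the indicator `δ y`. Identities of
    -- formal sums below are therefore proved by evaluating both sides against an arbitrary `F`,
    -- without computing coefficients.
    extend≈⇒≋ : ∀ p q → (∀ F → extend F p ≈ extend F q) → p ≋ q
    extend≈⇒≋ p q e y = begin
      coeff p y       ≈⟨ coeff≈extend p y ⟩
      extend (δ y) p  ≈⟨ e (δ y) ⟩
      extend (δ y) q  ≈⟨ coeff≈extend q y ⟨
      coeff q y       ∎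

    extend-· : ∀ (F : X → Carrier) k p → extend F (k · p) ≈ k * extend F p
    extend-· F k []            = ≈-sym (zeroʳ k)
    extend-· F k ((l , x) ∷ p) =
      ≈-trans (+-cong (*-assoc k l _) (extend-· F k p)) (≈-sym (distribˡ k _ _))

    -- If all coefficients of a sum vanish, deleting the occurrences of its first
    -- element changes no linear extension, and makes the sum shorter.
    private
      delete : X → Combination → Combination
      delete x []            = []
      delete x ((k , y) ∷ p) with y ≟ x
      ... | yes _ = delete x p
      ... | no  _ = (k , y) ∷ delete x p

      length-delete : ∀ x p → length (delete x p) ℕ.≤ length p
      length-delete x []            = z≤n
      length-delete x ((k , y) ∷ p) with y ≟ x
      ... | yes _ = ℕ.m≤n⇒m≤1+n (length-delete x p)
      ... | no  _ = s≤s (length-delete x p)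

      extend-delete : ∀ (F : X → Carrier) x p →
                      extend F p ≈ coeff p x * F x + extend F (delete x p)
      extend-delete F x [] = ≈-sym (≈-trans (+-identityʳ _) (zeroˡ _))
      extend-delete F x ((k , y) ∷ p) with y ≟ x
      ... | yes refl = begin
        k * F x + extend F p
          ≈⟨ +-congˡ (extend-delete F x p) ⟩
        k * F x + (coeff p x * F x + extend F (delete x p))
          ≈⟨ +-assoc _ _ _ ⟨
        k * F x + coeff p x * F x + extend F (delete x p)
          ≈⟨ +-congʳ (distribʳ _ _ _) ⟨
        (k + coeff p x) * F x + extend F (delete x p) ∎
      ... | no _ = begin
        k * F y + extend F p
          ≈⟨ +-congˡ (extend-delete F x p) ⟩
        k * F y + (coeff p x * F x + extend F (delete x p))
          ≈⟨ x∙yz≈y∙xz _ _ _ ⟩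
        coeff p x * F x + (k * F y + extend F (delete x p))
          ≈⟨ +-congʳ (*-congʳ (+-identityˡ _)) ⟨
        (0# + coeff p x) * F x + (k * F y + extend F (delete x p)) ∎

      extend-delete-≋[] : ∀ (F : X → Carrier) x p → p ≋ [] →
                          extend F p ≈ extend F (delete x p)
      extend-delete-≋[] F x p e = begin
        extend F p
          ≈⟨ extend-delete F x p ⟩
        coeff p x * F x + extend F (delete x p)
          ≈⟨ +-congʳ (≈-trans (*-congʳ (e x)) (zeroˡ _)) ⟩
        0# + extend F (delete x p)
          ≈⟨ +-identityˡ _ ⟩
        extend F (delete x p) ∎

      delete-≋[] : ∀ x p → p ≋ [] → delete x p ≋ []
      delete-≋[] x p e y = begin
        coeff (delete x p) y       ≈⟨ coeff≈extend (delete x p) y ⟩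
        extend (δ y) (delete x p)  ≈⟨ extend-delete-≋[] (δ y) x p e ⟨
        extend (δ y) p             ≈⟨ coeff≈extend p y ⟨
        coeff p y                  ≈⟨ e y ⟩
        0#                         ∎

      delete-head : ∀ k x p → delete x ((k , x) ∷ p) ≡ delete x p
      delete-head k x p with x ≟ x
      ... | yes _   = refl
      ... | no  x≢x = contradiction refl x≢x

      -- The bound `n` makes the recursion structural, since `delete x p` is not a subterm of the
      -- sum.
      extend-≋[] : ∀ n (F : X → Carrier) p → length p ℕ.≤ n → p ≋ [] →
                   extend F p ≈ 0#
      extend-≋[] n         F []            _         e = ≈-refl
      extend-≋[] (ℕ.suc n) F ((k , x) ∷ p) (s≤s p≤n) e = begin
        extend F ((k , x) ∷ p)
          ≈⟨ extend-delete-≋[] F x ((k , x) ∷ p) e ⟩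
        extend F (delete x ((k , x) ∷ p))
          ≡⟨ cong (extend F) (delete-head k x p) ⟩
        extend F (delete x p)
          ≈⟨ extend-≋[] n F (delete x p) (ℕ.≤-trans (length-delete x p) p≤n)
               (subst (_≋ []) (delete-head k x p) (delete-≋[] x ((k , x) ∷ p) e)) ⟩
        0# ∎

    -- By linearity it is enough to treat the difference `p ++ neg q`, all of whose coefficients
    -- vanish.
    extend-≋ : ∀ (F : X → Carrier) p q → p ≋ q → extend F p ≈ extend F q
    extend-≋ F p q e = GroupProperties.x∙y⁻¹≈ε⇒x≈y +-group _ _ (begin
      extend F p - extend F q
        ≈⟨ +-congˡ (≈-trans (extend-· F (- 1#) q) (-1*x≈-x _)) ⟨
      extend F p + extend F (neg q)
        ≈⟨ extend-++ F p (neg q) ⟨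
      extend F (p ++ neg q)
        ≈⟨ extend-≋[] _ F (p ++ neg q) ℕ.≤-refl p-q≋[] ⟩
      0# ∎)
      where
      open import Algebra.Properties.Ring ring using (-1*x≈-x)
      p-q≋[] : p ++ neg q ≋ []
      p-q≋[] y = begin
        coeff (p ++ neg q) y         ≈⟨ coeff-++ p (neg q) y ⟩
        coeff p y + coeff (neg q) y  ≈⟨ +-cong (e y) (coeff-neg q y) ⟩
        coeff q y - coeff q y        ≈⟨ -‿inverseʳ _ ⟩
        0#                           ∎

  -- Multilinear extension to families of formal sums.

  module _ {a} {A : Set a} {x} {X : Set x} where

    -- The scalar counterpart of `multilinear`: nested sums, one per letter of `u`, with no expanded
    -- list of families in between.
    extendₘ : ∀ {u : List A} → (All (const X) u → Carrier) →
              All (const (FormalSum X)) u → Carrier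
    extendₘ F []       = F []
    extendₘ F (p ∷ ps) = extend (λ x → extendₘ (λ xs → F (x ∷ xs)) ps) p

    extendₘ-cong : ∀ {u : List A} {F G : All (const X) u → Carrier} →
                   (∀ xs → F xs ≈ G xs) → ∀ ps → extendₘ F ps ≈ extendₘ G ps
    extendₘ-cong e []       = e []
    extendₘ-cong e (p ∷ ps) =
      extend-cong (λ x → extendₘ-cong (λ xs → e (x ∷ xs)) ps) p

    extendₘ-++ : ∀ {u : List A} (F : All (const X) u → Carrier) ps {a} (i : a ∈ u) p q →
                 extendₘ F (ps [ i ]≔ (p ++ q)) ≈
                 extendₘ F (ps [ i ]≔ p) + extendₘ F (ps [ i ]≔ q)
    extendₘ-++ F (_ ∷ ps) (here refl) p q = extend-++ _ p q
    extendₘ-++ F (r ∷ ps) (there i)   p q = ≈-trans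
      (extend-cong (λ x → extendₘ-++ (λ xs → F (x ∷ xs)) ps i p q) r)
      (extend-+ _ _ r)

    -- The two blocks appear in the same order as in the whole family, so the nested sums are merely
    -- regrouped and no two of them are exchanged.
    extendₘ-split :
      ∀ (g : A → A) (v u : List A)
      (H : All (const X) v → All (const X) u → Carrier)
      (ps : All (const (FormalSum X)) (List.map g v ++ u)) →
      extendₘ (λ xs → extendₘ (H xs) (All.++⁻ʳ (List.map g v) ps))
              (All.map⁻ (All.++⁻ˡ (List.map g v) ps)) ≈
      extendₘ (λ xs → H (All.map⁻ (All.++⁻ˡ (List.map g v) xs))
                        (All.++⁻ʳ (List.map g v) xs)) ps
    extendₘ-split g []      u H ps       = ≈-refl
    extendₘ-split g (b ∷ v) u H (p ∷ ps) =
      extend-cong (λ x → extendₘ-split g v u (λ xs → H (x ∷ xs)) ps) p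

  extendₘ-map : ∀ {a x y} {A : Set a} {X : Set x} {Y : Set y} {u : List A}
                (F : All (const Y) u → Carrier) (f : X → Y)
                (ps : All (const (FormalSum X)) u) →
                extendₘ F (All.map (List.map (map₂ f)) ps) ≈ extendₘ (F ∘ All.map f) ps
  extendₘ-map F f []       = ≈-refl
  extendₘ-map F f (p ∷ ps) = ≈-trans
    (extend-map₂ _ f p)
    (extend-cong (λ x → extendₘ-map (λ ys → F (f x ∷ ys)) f ps) p)

  module _ {x} {X : Set x} (_≟_ : DecidableEquality X) where

    open Free R _≟_

    module _ {a} {A : Set a} where

      extendₘ-· : ∀ {u : List A} (F : All (const X) u → Carrier) ps {a} (i : a ∈ u) k p →
                  extendₘ F (ps [ i ]≔ (k · p)) ≈ k * extendₘ F (ps [ i ]≔ p)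
      extendₘ-· F (_ ∷ ps) (here refl) k p = extend-· _≟_ _ k p
      extendₘ-· F (r ∷ ps) (there i)   k p = ≈-trans
        (extend-cong (λ x → extendₘ-· (λ xs → F (x ∷ xs)) ps i k p) r)
        (extend-* k _ r)

      extendₘ-≋ : ∀ {u : List A} (F : All (const X) u → Carrier) ps qs →
                  (∀ {a} (i : a ∈ u) → All.lookup ps i ≋ All.lookup qs i) →
                  extendₘ F ps ≈ extendₘ F qs
      extendₘ-≋ F []       []       e = ≈-refl
      extendₘ-≋ F (p ∷ ps) (q ∷ qs) e = ≈-trans
        (extend-≋ _≟_ _ p q (e (here refl)))
        (extend-cong (λ x → extendₘ-≋ (λ xs → F (x ∷ xs)) ps qs (λ i → e (there i))) q)

      extend-expand : ∀ {u : List A} (F : All (const X) u → Carrier) ps →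
                      extend F (expand ps) ≈ extendₘ F ps
      extend-expand F []       = ≈-trans (+-identityʳ _) (*-identityˡ _)
      extend-expand F (p ∷ ps) = ≈-trans
        (extend-cartesianProductWith F (λ x xs → x ∷ xs) p (expand ps))
        (extend-cong (λ x → extend-expand (λ xs → F (x ∷ xs)) ps) p)

      -- This turns every test of a `multilinear` operation into nested sums, on which the remaining
      -- arguments operate.
      extend-multilinear : ∀ {u : List A} (F : X → Carrier) (f : All (const X) u → X) ps →
                           extend F (multilinear f ps) ≈ extendₘ (F ∘ f) ps
      extend-multilinear F f ps =
        ≈-trans (extend-map₂ F f (expand ps)) (extend-expand (F ∘ f) ps)

    -- Summing over the value of `multilinear f` at the grafted position amounts to summing over the
    -- arguments of `f`. Grafting of formal sums thus reduces to grafting of basis elements.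
    extendₘ-graft :
      ∀ {γ} (u : Word γ) i (v : Word γ) (F : All (const X) u → Carrier)
      (f : All (const X) v → X) (ps : All (const Combination) (u ∘⟨ i ⟩ v)) →
      extendₘ F (graft u i v (multilinear f) ps) ≈ extendₘ (λ xs → F (graft u i v f xs)) ps
    extendₘ-graft (a ∷ u) zero v F f ps = ≈-trans
      (extend-multilinear _ f (All.map⁻ (All.++⁻ˡ (List.map (a ↑_) v) ps)))
      (extendₘ-split (a ↑_) v u (λ xs zs → F (f xs ∷ zs)) ps)
    extendₘ-graft (a ∷ u) (suc i) v F f (p ∷ ps) =
      extend-cong (λ x → extendₘ-graft u i v (λ xs → F (x ∷ xs)) f ps) p

    -- Algebras obtained by linearising an action on basis elements.

    module _ {γ : ℕ} (op : (x : Dias γ) → All (const X) (value x) → X)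
             (op-unit : ∀ x → op unitᴰ (x ∷ []) ≡ x)
             (op-∘ : ∀ x i y es →
                     op (compᴰ x i y) es ≡ op x (graft (value x) i (value y) (op y) es))
             where

      private
        act : Action γ freeModule
        act x = multilinear (op x)

        extend-act : ∀ x F es → extend F (act x es) ≈ extendₘ (F ∘ op x) es
        extend-act x F = extend-multilinear F (op x)

      -- Tested against `F`, each axiom becomes an identity of nested sums. Congruence and linearity
      -- then hold for any `op`, while the unit and composition axioms follow termwise from
      -- `op-unit` and `op-∘`.
      multilinear-isDiasAlgebra : IsDiasAlgebra γ freeModule act
      multilinear-isDiasAlgebra = record
        { act-cong = λ x {es} {es'} e → extend≈⇒≋ _≟_ (act x es) (act x es') λ F → begin
            extend F (act x es)    ≈⟨ extend-act x F es ⟩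
            extendₘ (F ∘ op x) es  ≈⟨ extendₘ-≋ (F ∘ op x) es es' e ⟩
            extendₘ (F ∘ op x) es' ≈⟨ extend-act x F es' ⟨
            extend F (act x es')   ∎
        ; act-+ = λ x es i e f →
            let es₊ = es [ i ]≔ (e ++ f)
                es₁ = es [ i ]≔ e
                es₂ = es [ i ]≔ f
            in extend≈⇒≋ _≟_ (act x es₊) (act x es₁ ++ act x es₂) λ F → begin
            extend F (act x es₊)
              ≈⟨ extend-act x F es₊ ⟩
            extendₘ (F ∘ op x) es₊
              ≈⟨ extendₘ-++ (F ∘ op x) es i e f ⟩
            extendₘ (F ∘ op x) es₁ + extendₘ (F ∘ op x) es₂
              ≈⟨ +-cong (extend-act x F es₁) (extend-act x F es₂) ⟨
            extend F (act x es₁) + extend F (act x es₂)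
              ≈⟨ extend-++ F (act x es₁) (act x es₂) ⟨
            extend F (act x es₁ ++ act x es₂) ∎
        ; act-* = λ x es i k e →
            let esₖ = es [ i ]≔ (k · e)
                es₁ = es [ i ]≔ e
            in extend≈⇒≋ _≟_ (act x esₖ) (k · act x es₁) λ F → begin
            extend F (act x esₖ)        ≈⟨ extend-act x F esₖ ⟩
            extendₘ (F ∘ op x) esₖ      ≈⟨ extendₘ-· (F ∘ op x) es i k e ⟩
            k * extendₘ (F ∘ op x) es₁  ≈⟨ *-congˡ (extend-act x F es₁) ⟨
            k * extend F (act x es₁)    ≈⟨ extend-· _≟_ F k (act x es₁) ⟨
            extend F (k · act x es₁)    ∎
        ; act-unit = λ e → extend≈⇒≋ _≟_ (act unitᴰ (e ∷ [])) e λ F → begin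
            extend F (act unitᴰ (e ∷ []))
              ≈⟨ extend-act unitᴰ F (e ∷ []) ⟩
            extend (λ x → F (op unitᴰ (x ∷ []))) e
              ≈⟨ extend-cong (λ x → reflexive (cong F (op-unit x))) e ⟩
            extend F e ∎
        ; act-∘ = λ x i y es →
            let es' = graft (value x) i (value y) (act y) es
            in extend≈⇒≋ _≟_ (act (compᴰ x i y) es) (act x es') λ F → begin
            extend F (act (compᴰ x i y) es)
              ≈⟨ extend-act (compᴰ x i y) F es ⟩
            extendₘ (F ∘ op (compᴰ x i y)) es
              ≈⟨ extendₘ-cong (λ xs → reflexive (cong F (op-∘ x i y xs))) es ⟩
            extendₘ (λ xs → F (op x (graft (value x) i (value y) (op y) xs))) es
              ≈⟨ extendₘ-graft (value x) i (value y) (F ∘ op x) (op y) es ⟨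
            extendₘ (F ∘ op x) es'
              ≈⟨ extend-act x F es' ⟨
            extend F (act x es') ∎
        }

-- Associativity of the composition of words.

module _ {γ : ℕ} where

  private
    module ↑ = Max (Fin.≤-totalOrder (ℕ.suc γ))

  zero-↑ : ∀ b → zero {γ} ↑ b ≡ b
  zero-↑ b = ↑.x≤y⇒x⊔y≈y {b} {zero} z≤n

  map-zero-↑ : ∀ (w : Word γ) → List.map (zero ↑_) w ≡ w
  map-zero-↑ w = trans (List.map-cong zero-↑ w) (List.map-id w)

  map-↑≡h : ∀ a (w : Word γ) → List.map (letter a ↑_) w ≡ h a w
  map-↑≡h a = List.map-cong λ b → letter-↑ b (b Fin.<? letter a)
    where
    -- Abstracting the decision allows a match on it to reduce the conditional in `h`.
    letter-↑ : ∀ b (b<a? : Dec (b Fin.< letter a)) →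
               letter a ↑ b ≡ (if does b<a? then letter a else b)
    letter-↑ b (yes b<a) = ↑.x≤y⇒y⊔x≈y {letter a} {b} (ℕ.<⇒≤ b<a)
    letter-↑ b (no  b≮a) = ↑.x≤y⇒x⊔y≈y {b} {letter a} (ℕ.≮⇒≥ b≮a)

  compose-++ : ∀ (u v : Word γ) ws →
               compose (u ++ v) ws ≡ compose u (All.++⁻ˡ u ws) ++ compose v (All.++⁻ʳ u ws)
  compose-++ []      v ws       = refl
  compose-++ (a ∷ u) v (w ∷ ws) = begin
    List.map (a ↑_) w ++ compose (u ++ v) ws
      ≡⟨ cong (List.map (a ↑_) w ++_) (compose-++ u v ws) ⟩
    List.map (a ↑_) w ++ (compose u (All.++⁻ˡ u ws) ++ compose v (All.++⁻ʳ u ws))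
      ≡⟨ List.++-assoc (List.map (a ↑_) w) _ _ ⟨
    (List.map (a ↑_) w ++ compose u (All.++⁻ˡ u ws)) ++ compose v (All.++⁻ʳ u ws) ∎
    where open ≡-Reasoning

  -- Associativity of the maximum, applied letter by letter: raising the letters of `v` before
  -- composing raises the whole result.
  compose-map : ∀ a (v : Word γ) (ws : All (const (Word γ)) (List.map (a ↑_) v)) →
                compose (List.map (a ↑_) v) ws ≡ List.map (a ↑_) (compose v (All.map⁻ ws))
  compose-map a []      []       = refl
  compose-map a (b ∷ v) (w ∷ ws) = begin
    List.map ((a ↑ b) ↑_) w ++ compose (List.map (a ↑_) v) ws
      ≡⟨ cong₂ _++_ (trans (List.map-cong (↑.⊔-assoc a b) w) (List.map-∘ w))
                    (compose-map a v ws) ⟩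
    List.map (a ↑_) (List.map (b ↑_) w) ++ List.map (a ↑_) (compose v (All.map⁻ ws))
      ≡⟨ List.map-++ (a ↑_) (List.map (b ↑_) w) _ ⟨
    List.map (a ↑_) (List.map (b ↑_) w ++ compose v (All.map⁻ ws)) ∎
    where open ≡-Reasoning

  -- Associativity of operadic composition. At the grafted position the operands split into those
  -- over `v` and those over the rest of `u`; the raise by `a` then factors out of the first block.
  compose-graft : ∀ (u : Word γ) i (v : Word γ) ws →
                  compose (u ∘⟨ i ⟩ v) ws ≡ compose u (graft u i v (compose v) ws)
  compose-graft (a ∷ u) zero v ws = trans
    (compose-++ (List.map (a ↑_) v) u ws)
    (cong (_++ compose u (All.++⁻ʳ (List.map (a ↑_) v) ws)) (compose-map a v _))
  compose-graft (a ∷ u) (suc i) v (w ∷ ws) =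
    cong (List.map (a ↑_) w ++_) (compose-graft u i v ws)

  module _ {m n} {M : Set m} {N : Set n} (g : M → N) where

    map-++⁻ˡ : ∀ (u : Word γ) {v : Word γ} (es : All (const M) (u ++ v)) →
               All.map g (All.++⁻ˡ u es) ≡ All.++⁻ˡ u (All.map g es)
    map-++⁻ˡ []      es       = refl
    map-++⁻ˡ (_ ∷ u) (e ∷ es) = cong (g e ∷_) (map-++⁻ˡ u es)

    map-++⁻ʳ : ∀ (u : Word γ) {v : Word γ} (es : All (const M) (u ++ v)) →
               All.map g (All.++⁻ʳ u es) ≡ All.++⁻ʳ u (All.map g es)
    map-++⁻ʳ []      es       = refl
    map-++⁻ʳ (_ ∷ u) (e ∷ es) = map-++⁻ʳ u es

    map-map⁻ : ∀ (f : Fin (ℕ.suc γ) → Fin (ℕ.suc γ)) (u : Word γ)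
               (es : All (const M) (List.map f u)) →
               All.map g (All.map⁻ es) ≡ All.map⁻ (All.map g es)
    map-map⁻ f []      []       = refl
    map-map⁻ f (_ ∷ u) (e ∷ es) = cong (g e ∷_) (map-map⁻ f u es)

    -- Grafting only regroups operands, so it is natural in their type. It is applied to `value`, to
    -- pass from words bundled with proofs to bare words.
    map-graft : ∀ (u : Word γ) i (v : Word γ)
                {f : All (const M) v → M} {f' : All (const N) v → N} →
                (∀ es → g (f es) ≡ f' (All.map g es)) → ∀ es →
                All.map g (graft u i v f es) ≡ graft u i v f' (All.map g es)
    map-graft (a ∷ u) zero v {f' = f'} gf≡f'g es = cong₂ _∷_
      (trans (gf≡f'g _) (cong f' (trans (map-map⁻ (a ↑_) v _)
                                        (cong All.map⁻ (map-++⁻ˡ (List.map (a ↑_) v) es)))))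
      (map-++⁻ʳ (List.map (a ↑_) v) es)
    map-graft (a ∷ u) (suc i) v gf≡f'g (e ∷ es) = cong (g e ∷_) (map-graft u i v gf≡f'g es)

  -- Generated words are the words with one zero.

  zeros-++ : ∀ (u v : Word γ) → zeros (u ++ v) ≡ zeros u ℕ.+ zeros v
  zeros-++ u v =
    trans (cong length (List.filter-++ (Fin._≟ zero) u v))
          (List.length-++ (filter (Fin._≟ zero) u))

  zeros-map-suc-↑ : ∀ a (w : Word γ) → zeros (List.map (suc a ↑_) w) ≡ 0
  zeros-map-suc-↑ a w =
    cong length (List.filter-none (Fin._≟ zero) (All.map⁺ (All.universal nonzero w)))
    where
    nonzero : ∀ b → ¬ (suc a ↑ b ≡ zero)
    -- Otherwise `suc a`, being below the maximum, would be at most `zero`.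
    nonzero b a↑b≡0 with () ← subst (suc a Fin.≤_) a↑b≡0 (↑.x≤x⊔y (suc a) b)

  zeros-∘ : ∀ (u : Word γ) i (v : Word γ) → zeros v ≡ 1 → zeros (u ∘⟨ i ⟩ v) ≡ zeros u
  zeros-∘ (zero ∷ u) zero v v≡1 =
    trans (zeros-++ (List.map (zero ↑_) v) u)
          (cong (ℕ._+ zeros u) (trans (cong zeros (map-zero-↑ v)) v≡1))
  zeros-∘ (suc a ∷ u) zero v v≡1 =
    trans (zeros-++ (List.map (suc a ↑_) v) u)
          (cong (ℕ._+ zeros u) (zeros-map-suc-↑ a v))
  zeros-∘ (zero  ∷ u) (suc i) v v≡1 = cong ℕ.suc (zeros-∘ u i v v≡1)
  zeros-∘ (suc _ ∷ u) (suc i) v v≡1 = zeros-∘ u i v v≡1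

  Generated⇒zeros≡1 : ∀ {w : Word γ} → Generated w → zeros w ≡ 1
  Generated⇒zeros≡1 unit             = refl
  Generated⇒zeros≡1 (left a)         = refl
  Generated⇒zeros≡1 (right a)        = refl
  Generated⇒zeros≡1 (comp {u} p i q) =
    trans (zeros-∘ u i _ (Generated⇒zeros≡1 q)) (Generated⇒zeros≡1 p)

  -- The argument `w` is an accumulator, extended on the right by one letter of `v` at each call. A
  -- `zero` at the head of `v` contradicts the count.
  Generated-++ : ∀ {w : Word γ} → Generated w → ∀ v → zeros v ≡ 0 → Generated (w ++ v)
  Generated-++ {w} p []          _   = subst Generated (sym (List.++-identityʳ w)) p
  Generated-++ {w} p (suc a ∷ v) v≡0 = subst Generated
    (trans (cong (λ w → (w ++ suc a ∷ []) ++ v) (map-zero-↑ w))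
           (List.++-assoc w (suc a ∷ []) v))
    (Generated-++ (comp (left a) zero p) v v≡0)

  zeros≡1⇒Generated : ∀ (w : Word γ) → zeros w ≡ 1 → Generated w
  zeros≡1⇒Generated (zero  ∷ w) w≡1 = Generated-++ unit w (ℕ.suc-injective w≡1)
  zeros≡1⇒Generated (suc a ∷ w) w≡1 =
    subst (λ w → Generated (suc a ∷ w))
          (trans (List.++-identityʳ _) (map-zero-↑ w))
          -- Position `suc zero` is that of the `0` in `a ·0`, so `w` is inserted unchanged after
          -- `suc a`.
          (comp (right a) (suc zero) (zeros≡1⇒Generated w w≡1))

  -- The action transported to words with one zero.

  toOneZero : Dias γ → OneZero γ
  toOneZero (w ,ʳ p) = w ,ʳ Irrelevant.map Generated⇒zeros≡1 p

  fromOneZero : OneZero γ → Dias γ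
  fromOneZero (w ,ʳ p) = w ,ʳ Irrelevant.map (zeros≡1⇒Generated w) p

  -- Going through `Dias γ` makes closure under the operad supply the proof that the result has a
  -- single zero.
  composeᴼ : (x : Dias γ) → All (const (OneZero γ)) (value x) → OneZero γ
  composeᴼ x ws = toOneZero (composeᴰ x (All.map fromOneZero ws))

  value-composeᴼ : ∀ x ws → value (composeᴼ x ws) ≡ compose (value x) (All.map value ws)
  value-composeᴼ x ws = cong (compose (value x)) (All.map-∘ ws)

  composeᴼ-unit : ∀ w → composeᴼ unitᴰ (w ∷ []) ≡ w
  composeᴼ-unit (w ,ʳ _) =
    value-injective (trans (List.++-identityʳ _) (map-zero-↑ w))

  composeᴼ-∘ : ∀ x i y ws →
               composeᴼ (compᴰ x i y) ws ≡
               composeᴼ x (graft (value x) i (value y) (composeᴼ y) ws)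
  composeᴼ-∘ x i y ws = value-injective (begin
    value (composeᴼ (compᴰ x i y) ws)
      ≡⟨ value-composeᴼ (compᴰ x i y) ws ⟩
    compose (u ∘⟨ i ⟩ v) (All.map value ws)
      ≡⟨ compose-graft u i v (All.map value ws) ⟩
    compose u (graft u i v (compose v) (All.map value ws))
      ≡⟨ cong (compose u) (map-graft value u i v (value-composeᴼ y) ws) ⟨
    compose u (All.map value (graft u i v (composeᴼ y) ws))
      ≡⟨ value-composeᴼ x _ ⟨
    value (composeᴼ x (graft u i v (composeᴼ y) ws)) ∎)
    where
    open ≡-Reasoning
    u = value x
    v = value y

  composeᴼ-left : ∀ a u v → composeᴼ (leftᴰ a) (u ∷ v ∷ []) ≡ ⊣-word a u v
  composeᴼ-left a (u ,ʳ _) (v ,ʳ _) = value-injective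
    (cong₂ _++_ (map-zero-↑ u) (trans (List.++-identityʳ _) (map-↑≡h a v)))

  composeᴼ-right : ∀ a u v → composeᴼ (rightᴰ a) (u ∷ v ∷ []) ≡ ⊢-word a u v
  composeᴼ-right a (u ,ʳ _) (v ,ʳ _) = value-injective
    (cong₂ _++_ (map-↑≡h a u) (trans (List.++-identityʳ _) (map-zero-↑ v)))

  -- Equivariance of the bijection of bases. Both sides compose the same bare words, because the
  -- conversions leave `value` unchanged.
  toOneZero-compose : ∀ x ys → toOneZero (composeᴰ x ys) ≡ composeᴼ x (All.map toOneZero ys)
  toOneZero-compose x ys = value-injective (cong (compose (value x)) (begin
    All.map value ys
      ≡⟨ All.map-∘ ys ⟨
    All.map value (All.map toOneZero ys)
      ≡⟨ All.map-∘ (All.map toOneZero ys) ⟨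
    All.map value (All.map fromOneZero (All.map toOneZero ys)) ∎))
    where open ≡-Reasoning

-- The pluriassociative structure and the isomorphism with the free algebra.

module _ {c ℓ} (R : CommutativeRing c ℓ) (γ : ℕ) where

  open CommutativeRing R using (setoid; reflexive; -_; 1#)
  open LinearExtension R
  open OneZeroWords R γ
  open ≈-Reasoning setoid
  private
    module F = FreeDias R γ
    _≟ᴰ_ : DecidableEquality (Dias γ)
    _≟ᴰ_ = Refinement._≟_ _≟ʷ_
    _≟ᴼ_ : DecidableEquality (OneZero γ)
    _≟ᴼ_ = Refinement._≟_ _≟ʷ_

  -- The two lists differ: `expand` leaves an extra factor `1#`, from the empty family, in each
  -- coefficient. They agree once evaluated against `F`.
  multilinear-binary :
    ∀ (a b : Fin (ℕ.suc γ)) (f : All (const (OneZero γ)) (a ∷ b ∷ []) → OneZero γ) g →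
    (∀ u v → f (u ∷ v ∷ []) ≡ g u v) →
    ∀ p q → multilinear f (p ∷ q ∷ []) ≋ bilinear g p q
  multilinear-binary a b f g f≡g p q = extend≈⇒≋ _≟ᴼ_
    (multilinear f (p ∷ q ∷ [])) (bilinear g p q) λ F → begin
    extend F (multilinear f (p ∷ q ∷ []))
      ≈⟨ extend-multilinear _≟ᴼ_ F f (p ∷ q ∷ []) ⟩
    extend (λ u → extend (λ v → F (f (u ∷ v ∷ []))) q) p
      ≈⟨ extend-cong (λ u → extend-cong (λ v → reflexive (cong F (f≡g u v))) q) p ⟩
    extend (λ u → extend (λ v → F (g u v)) q) p
      ≈⟨ extend-cartesianProductWith F g p q ⟨
    extend F (bilinear g p q) ∎

  isPluriassociative : IsPluriassociative γ freeModule _⊣⟨_⟩_ _⊢⟨_⟩_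
  isPluriassociative = record
    { act           = λ x → multilinear (composeᴼ x)
    ; isDiasAlgebra =
        multilinear-isDiasAlgebra _≟ᴼ_ composeᴼ composeᴼ-unit composeᴼ-∘
    ; act-left      = λ a → multilinear-binary zero (letter a) _ (⊣-word a) (composeᴼ-left a)
    ; act-right     = λ a → multilinear-binary (letter a) zero _ (⊢-word a) (composeᴼ-right a)
    }

  private
    φ : F.Combination → Combination
    φ = List.map (map₂ toOneZero)

    φ⁻¹ : Combination → F.Combination
    φ⁻¹ = List.map (map₂ fromOneZero)

    φ⁻¹∘φ : ∀ p → φ⁻¹ (φ p) ≡ p
    -- The conversions alter only an irrelevant proof, so their composite is definitionally the
    -- identity and `List.map-id` applies.
    φ⁻¹∘φ p = trans (sym (List.map-∘ p)) (List.map-id p)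

    φ∘φ⁻¹ : ∀ p → φ (φ⁻¹ p) ≡ p
    φ∘φ⁻¹ p = trans (sym (List.map-∘ p)) (List.map-id p)

    -- A test function on the target pulls back along `toOneZero` to one on the source, where
    -- `extend-≋` applies.
    φ-cong : ∀ p q → p F.≋ q → φ p ≋ φ q
    φ-cong p q p≋q = extend≈⇒≋ _≟ᴼ_ (φ p) (φ q) λ F → begin
      extend F (φ p)              ≈⟨ extend-map₂ F toOneZero p ⟩
      extend (F ∘ toOneZero) p    ≈⟨ extend-≋ _≟ᴰ_ (F ∘ toOneZero) p q p≋q ⟩
      extend (F ∘ toOneZero) q    ≈⟨ extend-map₂ F toOneZero q ⟨
      extend F (φ q)              ∎

    φ⁻¹-cong : ∀ p q → p ≋ q → φ⁻¹ p F.≋ φ⁻¹ q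
    φ⁻¹-cong p q p≋q = extend≈⇒≋ _≟ᴰ_ (φ⁻¹ p) (φ⁻¹ q) λ F → begin
      extend F (φ⁻¹ p)            ≈⟨ extend-map₂ F fromOneZero p ⟩
      extend (F ∘ fromOneZero) p  ≈⟨ extend-≋ _≟ᴼ_ (F ∘ fromOneZero) p q p≋q ⟩
      extend (F ∘ fromOneZero) q  ≈⟨ extend-map₂ F fromOneZero q ⟨
      extend F (φ⁻¹ q)            ∎

    φ-· : ∀ k p → φ (k F.· p) ≡ k · φ p
    φ-· k p = trans (sym (List.map-∘ p)) (List.map-∘ p)

    ≡⇒≋ : ∀ {p q} → p ≡ q → p ≋ q
    ≡⇒≋ = Module.≈ᴹ-reflexive freeModule

    φ-iso : IsModuleIsomorphism (Module.rawModule F.freeModule) (Module.rawModule freeModule) φ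
    φ-iso = record
      { isModuleMonomorphism = record
        { isModuleHomomorphism = record
          { isBimoduleHomomorphism = record
            { +ᴹ-isGroupHomomorphism = record
              { isMonoidHomomorphism = record
                { isMagmaHomomorphism = record
                  { isRelHomomorphism = record { cong = λ {p} {q} → φ-cong p q }
                  ; homo              = λ p q → ≡⇒≋ (List.map-++ _ p q)
                  }
                ; ε-homo = λ y → CommutativeRing.refl R
                }
              ; ⁻¹-homo = λ p → ≡⇒≋ (φ-· (- 1#) p)
              }
            ; *ₗ-homo = λ k p → ≡⇒≋ (φ-· k p)
            ; *ᵣ-homo = λ k p → ≡⇒≋ (φ-· k p)
            }
          }
        ; injective = λ {p} {q} φp≋φq →
            ≡.subst₂ F._≋_ (φ⁻¹∘φ p) (φ⁻¹∘φ q) (φ⁻¹-cong (φ p) (φ q) φp≋φq)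
        }
      -- Surjectivity concerns every `p` with the same coefficients as the preimage, hence the use
      -- of `φ-cong`.
      ; surjective = λ q → φ⁻¹ q , λ {p} p≋φ⁻¹q →
          subst (φ p ≋_) (φ∘φ⁻¹ q) (φ-cong p (φ⁻¹ q) p≋φ⁻¹q)
      }

    -- Under a test both sides become nested sums over `es`: `extendₘ-map` trades `φ` on the
    -- operands for `toOneZero` on basis elements, leaving the equivariance of the bijection.
    φ-act : ∀ x es → φ (F.freeAction x es) ≋ multilinear (composeᴼ x) (All.map φ es)
    φ-act x es = extend≈⇒≋ _≟ᴼ_
      (φ (F.freeAction x es)) (multilinear (composeᴼ x) (All.map φ es)) λ F → begin
      extend F (φ (F.freeAction x es))
        ≈⟨ extend-map₂ F toOneZero (F.freeAction x es) ⟩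
      extend (F ∘ toOneZero) (F.freeAction x es)
        ≈⟨ extend-multilinear _≟ᴰ_ (F ∘ toOneZero) (composeᴰ x) es ⟩
      extendₘ (F ∘ toOneZero ∘ composeᴰ x) es
        ≈⟨ extendₘ-cong (λ ys → reflexive (cong F (toOneZero-compose x ys))) es ⟩
      extendₘ (F ∘ composeᴼ x ∘ All.map toOneZero) es
        ≈⟨ extendₘ-map (F ∘ composeᴼ x) toOneZero es ⟨
      extendₘ (F ∘ composeᴼ x) (All.map φ es)
        ≈⟨ extend-multilinear _≟ᴼ_ F (composeᴼ x) (All.map φ es) ⟨
      extend F (multilinear (composeᴼ x) (All.map φ es)) ∎

  isFreePluriassociative :
    IsFreePluriassociativeOver γ freeModule _⊣⟨_⟩_ _⊢⟨_⟩_ zeroWord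
  isFreePluriassociative = record
    { isPluriassociative = isPluriassociative
    ; φ                  = φ
    ; φ-iso              = φ-iso
    ; φ-act              = φ-act
    ; φ-generator        = λ y → CommutativeRing.refl R
    }

proposition3p1p1 : ∀ {c ℓ₁ ℓ₂} (K : HeytingField c ℓ₁ ℓ₂) → CharacteristicZero K →
    (γ : ℕ) → let open OneZeroWords (scalars K) γ in
    IsFreePluriassociativeOver γ freeModule _⊣⟨_⟩_ _⊢⟨_⟩_ zeroWord
proposition3p1p1 K _ γ = isFreePluriassociative (scalars K) γ
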